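{- Let $G_1$ and $G_2$ be two vertex-disjoint simple connected graphs with $|V(G_1)|=n_1$, $|V(G_2)|=n_2$, $|E(G_1)|=m_1$, $|E(G_2)|=m_2$. Then the edge S-join $G_1\underline{\vee}_S G_2$ satisfies \[ F(G_1\underline{\vee}_S G_2)=F(G_1)+F(G_2)+3m_1M_1(G_2)+6m_1^{2}m_2+m_1(n_2+2)^3+n_2m_1^{3}. \]
   Context: For a simple graph $G$ and $v\in V(G)$, $d_G(v)$ is the degree of $v$. The first Zagreb index is $M_1(G)=\sum_{v\in V(G)}d_G(v)^2$ and the F-index is $F(G)=\sum_{v\in V(G)}d_G(v)^3$. The subdivision graph $S(G)$ is obtained from $G$ by inserting a new vertex into each edge of $G$ (replacing each edge by a path of length 2); let $I(G)$ denote the set of these inserted vertices, so $V(S(G))=V(G)\cup I(G)$. The edge S-join $G_1\underline{\vee}_S G_2$ is the graph obtained from $S(G_1)$ and $G_2$ (taken vertex-disjoint) by joining each vertex of $I(G_1)$ to every vertex of $G_2$ by an edge. -}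

module Defs where

open import Algebra.Properties.CommutativeMonoid.Sum using (sum-syntax)
open import Data.Empty using (⊥)
open import Data.Fin using (Fin; splitAt; _<?_)
open import Data.Fin.Properties using (_≟_)
open import Data.List using (List; length; filter; allFin; cartesianProduct; lookup)
open import Data.Nat using (ℕ; _+_; _^_)
open import Data.Nat.Properties using (+-0-commutativeMonoid)
open import Data.Product using (_×_; _,_; proj₁; proj₂)
open import Data.Sum using (_⊎_; inj₁; inj₂)
open import Data.Unit using (⊤; tt)
open import Function using (_on_)
open import Level using (0ℓ)
open import Relation.Binary using (Rel; Decidable; Symmetric; Irreflexive)
open import Relation.Binary.Construct.Closure.ReflexiveTransitive using (Star)
import Relation.Binary.Construct.On as On
open import Relation.Binary.PropositionalEquality using (_≡_; refl)
open import Relation.Nullary using (¬_; yes; no)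
open import Relation.Nullary.Decidable using (_×-dec_; _⊎-dec_)
import Relation.Unary as Unary

record Graph (n : ℕ) : Set₁ where
  field
    Adj    : Rel (Fin n) 0ℓ
    adj?   : Decidable Adj
    sym    : Symmetric Adj
    irrefl : Irreflexive _≡_ Adj

  -- Each edge {u , v} is listed exactly once, as the pair (u , v) with u < v.
  edges : List (Fin n × Fin n)
  edges = filter (λ (u , v) → (u <? v) ×-dec adj? u v)
                 (cartesianProduct (allFin n) (allFin n))

  size : ℕ
  size = length edges

  degree : Fin n → ℕ
  degree v = length (filter (adj? v) (allFin n))

  Connected : Set
  Connected = ∀ u v → Star Adj u v

open Graph public using (size; degree; Connected)

M₁ : ∀ {n} → Graph n → ℕ
M₁ {n} G = sum-syntax +-0-commutativeMonoid n (λ v → degree G v ^ 2)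

F-index : ∀ {n} → Graph n → ℕ
F-index {n} G = sum-syntax +-0-commutativeMonoid n (λ v → degree G v ^ 3)

module Subdivision {n : ℕ} (G : Graph n) where
  open Graph G using (edges)

  Incident : Fin n → Fin (size G) → Set
  Incident v e = v ≡ proj₁ (lookup edges e) ⊎ v ≡ proj₂ (lookup edges e)

  incident? : Decidable Incident
  incident? v e =
    (v ≟ proj₁ (lookup edges e)) ⊎-dec (v ≟ proj₂ (lookup edges e))

  -- inj₁ v is an original vertex, inj₂ e the vertex inserted into the edge e.
  SAdj : Rel (Fin n ⊎ Fin (size G)) 0ℓ
  SAdj (inj₁ u) (inj₁ v) = ⊥
  SAdj (inj₁ v) (inj₂ e) = Incident v e
  SAdj (inj₂ e) (inj₁ v) = Incident v e
  SAdj (inj₂ e) (inj₂ f) = ⊥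

  sAdj? : Decidable SAdj
  sAdj? (inj₁ u) (inj₁ v) = no λ ()
  sAdj? (inj₁ v) (inj₂ e) = incident? v e
  sAdj? (inj₂ e) (inj₁ v) = incident? v e
  sAdj? (inj₂ e) (inj₂ f) = no λ ()

  sAdj-sym : Symmetric SAdj
  sAdj-sym {inj₁ v} {inj₂ e} i = i
  sAdj-sym {inj₂ e} {inj₁ v} i = i

  sAdj-irrefl : ∀ x → ¬ SAdj x x
  sAdj-irrefl (inj₁ _) ()
  sAdj-irrefl (inj₂ _) ()

  subdivision : Graph (n + size G)
  subdivision = record
    { Adj    = SAdj on splitAt n
    ; adj?   = On.decidable (splitAt n) SAdj sAdj?
    ; sym    = λ {x} {y} → sAdj-sym {splitAt n x} {splitAt n y}
    ; irrefl = λ { {x} refl → sAdj-irrefl (splitAt n x) }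
    }

  IsInserted : Fin n ⊎ Fin (size G) → Set
  IsInserted (inj₁ _) = ⊥
  IsInserted (inj₂ _) = ⊤

  isInserted? : Unary.Decidable IsInserted
  isInserted? (inj₁ _) = no λ ()
  isInserted? (inj₂ _) = yes tt

  -- The set I(G) of inserted vertices of the subdivision graph.
  I : Unary.Pred (Fin (n + size G)) 0ℓ
  I x = IsInserted (splitAt n x)

  I? : Unary.Decidable I
  I? x = isInserted? (splitAt n x)

open Subdivision public using (subdivision; I; I?)

module EdgeSJoin {n₁ n₂ : ℕ} (G₁ : Graph n₁) (G₂ : Graph n₂) where
  private
    N = n₁ + size G₁
    module S  = Graph (subdivision G₁)
    module G₂ = Graph G₂

  JAdj : Rel (Fin N ⊎ Fin n₂) 0ℓ
  JAdj (inj₁ x) (inj₁ y) = S.Adj x y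
  JAdj (inj₁ x) (inj₂ w) = I G₁ x
  JAdj (inj₂ w) (inj₁ x) = I G₁ x
  JAdj (inj₂ v) (inj₂ w) = G₂.Adj v w

  jAdj? : Decidable JAdj
  jAdj? (inj₁ x) (inj₁ y) = S.adj? x y
  jAdj? (inj₁ x) (inj₂ w) = I? G₁ x
  jAdj? (inj₂ w) (inj₁ x) = I? G₁ x
  jAdj? (inj₂ v) (inj₂ w) = G₂.adj? v w

  jAdj-sym : Symmetric JAdj
  jAdj-sym {inj₁ x} {inj₁ y} a = S.sym a
  jAdj-sym {inj₁ x} {inj₂ w} a = a
  jAdj-sym {inj₂ w} {inj₁ x} a = a
  jAdj-sym {inj₂ v} {inj₂ w} a = G₂.sym a

  jAdj-irrefl : ∀ x → ¬ JAdj x x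
  jAdj-irrefl (inj₁ x) = S.irrefl refl
  jAdj-irrefl (inj₂ w) = G₂.irrefl refl

  edgeSJoin : Graph (N + n₂)
  edgeSJoin = record
    { Adj    = JAdj on splitAt N
    ; adj?   = On.decidable (splitAt N) JAdj jAdj?
    ; sym    = λ {x} {y} → jAdj-sym {splitAt N x} {splitAt N y}
    ; irrefl = λ { {x} refl → jAdj-irrefl (splitAt N x) }
    }

open EdgeSJoin public using () renaming (edgeSJoin to infixl 6 _∨S_)

{-# OPTIONS --safe #-}

-- In the join an original vertex of G₁ keeps its degree, an inserted vertex has
-- degree n₂ + 2, and a vertex w of G₂ has degree m₁ + d(w).  Expanding the cubes
-- (m₁ + d(w))³ and using the handshake identity Σ d(w) = 2 m₂ gives the formula.
-- An edge is a pair u < v, so the edges at v split into those with v as first end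
-- (its larger neighbours) and those with v as second end (its smaller neighbours):
-- this yields d(v), and double counting incidences then gives the handshake identity.
module Submission where

open import Defs
import Algebra.Properties.Semiring.Sum
open import Data.Bool using (if_then_else_; true; false)
open import Data.Fin using (Fin; zero; suc; splitAt; _<?_; _<_)
open import Data.Fin.Properties using (_≟_; <-cmp; <⇒≢; <-asym)
open import Data.List
  using (List; []; _∷_; _++_; length; filter; map; allFin; tabulate; cartesianProduct; lookup)
open import Data.List.Membership.Propositional.Properties using (∈-lookup; ∈-filter⁻)
open import Data.List.Properties using (map-++; map-∘)
import Data.Nat.ListAction as List
open import Data.Nat.ListAction.Properties using (sum-++)
open import Data.Nat using (ℕ; zero; suc; _+_; _*_; _^_)
open import Data.Nat.Properties
  using (+-*-semiring; +-assoc; +-comm; +-identityʳ; *-identityˡ; *-identityʳ; *-zeroʳ)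
open import Data.Nat.Solver using (module +-*-Solver)
open import Data.Product using (_×_; _,_; proj₁; proj₂)
open import Data.Sum using (_⊎_; inj₁; inj₂; map₁)
open import Function using (_∘_; id; mk⇔)
open import Relation.Binary.Definitions using (tri<; tri≈; tri>)
open import Relation.Binary.PropositionalEquality
  using (_≡_; refl; sym; trans; cong; cong₂; module ≡-Reasoning)
open import Relation.Nullary using (Dec; yes; no; does; ¬_; contradiction)
open import Relation.Nullary.Decidable using (_×-dec_; _⊎-dec_; does-⇔)
open import Relation.Unary using (Decidable)

open Algebra.Properties.Semiring.Sum +-*-semiring
  using (sum-syntax; sum-cong-≗; sum-replicate-zero; ∑-distrib-+; ∑-comm; *-distribˡ-sum)
open +-*-Solver using (solve; con; _:=_; _:+_; _:*_; _:^_)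
open ≡-Reasoning

-- Indicators of decidable propositions and finite sums.

⟦_⟧ : ∀ {p} {P : Set p} → Dec P → ℕ
⟦ P? ⟧ = if does P? then 1 else 0

module _ {p q} {P : Set p} {Q : Set q} where

  ⟦⟧-cong : (P → Q) → (Q → P) → (P? : Dec P) (Q? : Dec Q) → ⟦ P? ⟧ ≡ ⟦ Q? ⟧
  ⟦⟧-cong f g P? Q? = cong (if_then 1 else 0) (does-⇔ (mk⇔ f g) P? Q?)

  ⟦⊎⟧-disjoint : ¬ (P × Q) → (P? : Dec P) (Q? : Dec Q) → ⟦ P? ⊎-dec Q? ⟧ ≡ ⟦ P? ⟧ + ⟦ Q? ⟧
  ⟦⊎⟧-disjoint ¬pq (yes p) (yes q) = contradiction (p , q) ¬pq
  ⟦⊎⟧-disjoint ¬pq (yes _) (no  _) = refl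
  ⟦⊎⟧-disjoint ¬pq (no  _) (yes _) = refl
  ⟦⊎⟧-disjoint ¬pq (no  _) (no  _) = refl

-- If `R` fails, both sides vanish, so `P` and `Q` need to exclude each other only under `R`. This
-- matters because the two ends of a pair are known to differ only once the pair is an oriented
-- edge. The indicators of `P` and `Q` come first on the right, as in `∑-δ`.
⟦⟧-*-⟦⊎⟧ : ∀ {p q r} {P : Set p} {Q : Set q} {R : Set r} → ¬ (R × P × Q) →
            (R? : Dec R) (P? : Dec P) (Q? : Dec Q) →
            ⟦ R? ⟧ * ⟦ P? ⊎-dec Q? ⟧ ≡ ⟦ P? ⟧ * ⟦ R? ⟧ + ⟦ Q? ⟧ * ⟦ R? ⟧
⟦⟧-*-⟦⊎⟧ ¬rpq (no _)  P? Q? = sym (cong₂ _+_ (*-zeroʳ ⟦ P? ⟧) (*-zeroʳ ⟦ Q? ⟧))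
⟦⟧-*-⟦⊎⟧ ¬rpq (yes r) P? Q? = begin
  1 * ⟦ P? ⊎-dec Q? ⟧        ≡⟨ *-identityˡ _ ⟩
  ⟦ P? ⊎-dec Q? ⟧            ≡⟨ ⟦⊎⟧-disjoint (λ pq → ¬rpq (r , pq)) P? Q? ⟩
  ⟦ P? ⟧ + ⟦ Q? ⟧            ≡⟨ cong₂ _+_ (*-identityʳ ⟦ P? ⟧) (*-identityʳ ⟦ Q? ⟧) ⟨
  ⟦ P? ⟧ * 1 + ⟦ Q? ⟧ * 1    ∎

∑-zero : ∀ n → ∑[ i < n ] 0 ≡ 0
∑-zero = sum-replicate-zero

∑-const : ∀ n c → ∑[ i < n ] c ≡ n * c
∑-const zero    c = refl
∑-const (suc n) c = cong (c +_) (∑-const n c)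

∑-δ : ∀ {n} (j : Fin n) (f : Fin n → ℕ) → ∑[ i < n ] (⟦ j ≟ i ⟧ * f i) ≡ f j
∑-δ {suc n} zero    f = trans (cong₂ _+_ (+-identityʳ _) (∑-zero n)) (+-identityʳ _)
-- `⟦_⟧` looks only at `does`, so `⟦ suc j ≟ zero ⟧` computes to 0 and `⟦ suc j ≟ suc i ⟧` to
-- `⟦ j ≟ i ⟧`.
∑-δ {suc n} (suc j) f = ∑-δ j (f ∘ suc)

-- `incident?` has the summed vertex on the left of `≟`, hence the flip before `∑-δ` with constant
-- weight 1.
∑-δ-1 : ∀ {n} (j : Fin n) → ∑[ i < n ] ⟦ i ≟ j ⟧ ≡ 1
∑-δ-1 {n} j = trans
  (sum-cong-≗ {n} λ i → trans (⟦⟧-cong sym sym (i ≟ j) (j ≟ i)) (sym (*-identityʳ _)))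
  (∑-δ j (λ _ → 1))

-- Adjacency in the subdivision and in the join is defined through `splitAt`; this separates each
-- vertex sum into the contributions of the two kinds of vertices.
∑-splitAt : ∀ m {n} (g : Fin m ⊎ Fin n → ℕ) →
            ∑[ i < m + n ] g (splitAt m i) ≡ ∑[ i < m ] g (inj₁ i) + ∑[ j < n ] g (inj₂ j)
∑-splitAt zero    g = refl
∑-splitAt (suc m) g = trans (cong (g (inj₁ zero) +_) (∑-splitAt m (g ∘ map₁ suc)))
                            (sym (+-assoc (g (inj₁ zero)) _ _))

∑-cube-+ : ∀ {n} m (f : Fin n → ℕ) →
           ∑[ i < n ] ((m + f i) ^ 3) ≡
           n * m ^ 3 + 3 * m ^ 2 * ∑[ i < n ] f i + 3 * m * ∑[ i < n ] (f i ^ 2) + ∑[ i < n ] (f i ^ 3)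
∑-cube-+ {zero}  m f = lemma m
  where
  lemma : ∀ m → 0 ≡ 3 * m ^ 2 * 0 + 3 * m * 0 + 0
  lemma = solve 1 (λ m → con 0 := con 3 :* m :^ 2 :* con 0 :+ con 3 :* m :* con 0 :+ con 0) refl
∑-cube-+ {suc n} m f = trans (cong ((m + f zero) ^ 3 +_) (∑-cube-+ m (f ∘ suc))) (lemma m (f zero) n _ _ _)
  where
  lemma : ∀ m a n s₁ s₂ s₃ →
    (m + a) ^ 3 + (n * m ^ 3 + 3 * m ^ 2 * s₁ + 3 * m * s₂ + s₃) ≡
    (1 + n) * m ^ 3 + 3 * m ^ 2 * (a + s₁) + 3 * m * (a ^ 2 + s₂) + (a ^ 3 + s₃)
  lemma = solve 6 (λ m a n s₁ s₂ s₃ →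
    (m :+ a) :^ 3 :+ (n :* m :^ 3 :+ con 3 :* m :^ 2 :* s₁ :+ con 3 :* m :* s₂ :+ s₃) :=
    (con 1 :+ n) :* m :^ 3 :+ con 3 :* m :^ 2 :* (a :+ s₁) :+ con 3 :* m :* (a :^ 2 :+ s₂) :+ (a :^ 3 :+ s₃)) refl

-- List sums and lengths as finite sums.

module _ {a} {A : Set a} where

  ∑-lookup : (xs : List A) (g : A → ℕ) → ∑[ i < length xs ] g (lookup xs i) ≡ List.sum (map g xs)
  ∑-lookup []       g = refl
  ∑-lookup (x ∷ xs) g = cong (g x +_) (∑-lookup xs g)

  sum-map-tabulate : ∀ {n} (f : Fin n → A) (g : A → ℕ) → List.sum (map g (tabulate f)) ≡ ∑[ i < n ] g (f i)
  sum-map-tabulate {zero}  f g = refl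
  sum-map-tabulate {suc n} f g = cong (g (f zero) +_) (sum-map-tabulate (f ∘ suc) g)

  module _ {p} {P : A → Set p} (P? : Decidable P) where

    sum-map-filter : ∀ g xs → List.sum (map g (filter P? xs)) ≡ List.sum (map (λ x → ⟦ P? x ⟧ * g x) xs)
    sum-map-filter g []       = refl
    sum-map-filter g (x ∷ xs) with does (P? x)
    ... | true  = cong₂ _+_ (sym (+-identityʳ (g x))) (sum-map-filter g xs)
    ... | false = sum-map-filter g xs

    length-filter-tabulate : ∀ {n} (f : Fin n → A) → length (filter P? (tabulate f)) ≡ ∑[ i < n ] ⟦ P? (f i) ⟧
    length-filter-tabulate {zero}  f = refl
    length-filter-tabulate {suc n} f with does (P? (f zero))
    ... | true  = cong suc (length-filter-tabulate (f ∘ suc))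
    ... | false = length-filter-tabulate (f ∘ suc)

  sum-map-cartesianProduct : ∀ {b} {B : Set b} (g : A × B → ℕ) xs ys →
    List.sum (map g (cartesianProduct xs ys)) ≡ List.sum (map (λ x → List.sum (map (λ y → g (x , y)) ys)) xs)
  sum-map-cartesianProduct g []       ys = refl
  sum-map-cartesianProduct g (x ∷ xs) ys = begin
    List.sum (map g (map (x ,_) ys ++ cartesianProduct xs ys))
      ≡⟨ cong List.sum (map-++ g (map (x ,_) ys) _) ⟩
    List.sum (map g (map (x ,_) ys) ++ map g (cartesianProduct xs ys))
      ≡⟨ sum-++ (map g (map (x ,_) ys)) _ ⟩
    List.sum (map g (map (x ,_) ys)) + List.sum (map g (cartesianProduct xs ys))
      ≡⟨ cong₂ _+_ (cong List.sum (sym (map-∘ ys))) (sum-map-cartesianProduct g xs ys) ⟩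
    _ ∎

-- Edges, incidences and degrees in a single graph.

module _ {n} (G : Graph n) where
  open Graph G using (Adj; adj?; edges; irrefl) renaming (sym to adj-sym)
  open Subdivision G using (incident?)

  private
    oriented? : ∀ u v → Dec (u < v × Adj u v)
    oriented? u v = (u <? v) ×-dec adj? u v

    oriented : Fin n → Fin n → ℕ
    oriented u v = ⟦ oriented? u v ⟧

  degree-∑ : ∀ v → degree G v ≡ ∑[ u < n ] ⟦ adj? v u ⟧
  degree-∑ v = length-filter-tabulate (adj? v) {n} id

  -- `edges` filters the list of all ordered pairs, so the filter turns into an indicator weight and
  -- `lookup` disappears.
  ∑-edges : ∀ g → ∑[ e < size G ] g (lookup edges e) ≡ ∑[ u < n ] ∑[ v < n ] (oriented u v * g (u , v))
  ∑-edges g = begin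
    ∑[ e < size G ] g (lookup edges e)
      ≡⟨ ∑-lookup edges g ⟩
    List.sum (map g edges)
      ≡⟨ sum-map-filter (λ (u , v) → oriented? u v) g (cartesianProduct (allFin n) (allFin n)) ⟩
    List.sum (map (λ (u , v) → oriented u v * g (u , v)) (cartesianProduct (allFin n) (allFin n)))
      ≡⟨ sum-map-cartesianProduct _ (allFin n) (allFin n) ⟩
    List.sum (map (λ u → List.sum (map (λ v → oriented u v * g (u , v)) (allFin n))) (allFin n))
      ≡⟨ sum-map-tabulate {n = n} id _ ⟩
    ∑[ u < n ] List.sum (map (λ v → oriented u v * g (u , v)) (allFin n))
      ≡⟨ sum-cong-≗ {n} (λ u → sum-map-tabulate {n = n} id _) ⟩
    ∑[ u < n ] ∑[ v < n ] (oriented u v * g (u , v)) ∎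

  -- Members of a filtered list satisfy the filter. In particular the two ends of an edge are
  -- distinct.
  edge-ordered : ∀ e → proj₁ (lookup edges e) < proj₂ (lookup edges e)
  edge-ordered e = proj₁ (proj₂ (∈-filter⁻ (λ (u , v) → oriented? u v)
    {xs = cartesianProduct (allFin n) (allFin n)} (∈-lookup e)))

  -- Trichotomy of `<`: asymmetry excludes both orientations at once, and irreflexivity of adjacency
  -- excludes `u ≡ v`, so an adjacent pair is counted exactly once.
  oriented-+ : ∀ u v → oriented u v + oriented v u ≡ ⟦ adj? u v ⟧
  oriented-+ u v = trans
    (sym (⟦⊎⟧-disjoint (λ ((u<v , _) , (v<u , _)) → <-asym u<v v<u) (oriented? u v) (oriented? v u)))
    (⟦⟧-cong (λ { (inj₁ (_ , uv)) → uv ; (inj₂ (_ , vu)) → adj-sym vu }) orient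
             (oriented? u v ⊎-dec oriented? v u) (adj? u v))
    where
    orient : Adj u v → (u < v × Adj u v) ⊎ (v < u × Adj v u)
    orient uv with <-cmp u v
    ... | tri< u<v _ _ = inj₁ (u<v , uv)
    ... | tri≈ _ u≡v _ = contradiction uv (irrefl u≡v)
    ... | tri> _ _ v<u = inj₂ (v<u , adj-sym uv)

  ∑-incident-vertices : ∀ e → ∑[ v < n ] ⟦ incident? v e ⟧ ≡ 2
  ∑-incident-vertices e = begin
    ∑[ v < n ] ⟦ incident? v e ⟧
      ≡⟨ sum-cong-≗ {n} (λ v → ⟦⊎⟧-disjoint
           (λ (v≡x , v≡y) → <⇒≢ (edge-ordered e) (trans (sym v≡x) v≡y)) (v ≟ x) (v ≟ y)) ⟩
    ∑[ v < n ] (⟦ v ≟ x ⟧ + ⟦ v ≟ y ⟧)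
      ≡⟨ ∑-distrib-+ {n} _ _ ⟩
    ∑[ v < n ] ⟦ v ≟ x ⟧ + ∑[ v < n ] ⟦ v ≟ y ⟧
      ≡⟨ cong₂ _+_ (∑-δ-1 x) (∑-δ-1 y) ⟩
    2 ∎
    where
    x = proj₁ (lookup edges e)
    y = proj₂ (lookup edges e)

  ∑-incident-edges : ∀ v → ∑[ e < size G ] ⟦ incident? v e ⟧ ≡ degree G v
  ∑-incident-edges v = begin
    ∑[ e < size G ] ⟦ incident? v e ⟧
      ≡⟨ ∑-edges (λ (x , y) → ⟦ (v ≟ x) ⊎-dec (v ≟ y) ⟧) ⟩
    ∑[ x < n ] ∑[ y < n ] (oriented x y * ⟦ (v ≟ x) ⊎-dec (v ≟ y) ⟧)
      ≡⟨ sum-cong-≗ {n} (λ x → trans (sum-cong-≗ {n} (ends x)) (∑-distrib-+ {n} _ _)) ⟩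
    ∑[ x < n ] (∑[ y < n ] (⟦ v ≟ x ⟧ * oriented x y) + ∑[ y < n ] (⟦ v ≟ y ⟧ * oriented x y))
      -- The test `v ≟ x` is constant in `y` and factors out of the inner sum; the test `v ≟ y`
      -- collapses the inner sum to `y = v`.
      ≡⟨ sum-cong-≗ {n} (λ x → cong₂ _+_ (sym (*-distribˡ-sum {n} ⟦ v ≟ x ⟧ (oriented x))) (∑-δ v (oriented x))) ⟩
    ∑[ x < n ] (⟦ v ≟ x ⟧ * ∑[ y < n ] oriented x y + oriented x v)
      ≡⟨ ∑-distrib-+ {n} _ _ ⟩
    ∑[ x < n ] (⟦ v ≟ x ⟧ * ∑[ y < n ] oriented x y) + ∑[ x < n ] oriented x v
      -- The factored test now collapses the outer sum to `x = v`.
      ≡⟨ cong (_+ ∑[ x < n ] oriented x v) (∑-δ v (λ x → ∑[ y < n ] oriented x y)) ⟩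
    ∑[ y < n ] oriented v y + ∑[ x < n ] oriented x v
      ≡⟨ sym (∑-distrib-+ {n} _ _) ⟩
    ∑[ u < n ] (oriented v u + oriented u v)
      ≡⟨ sum-cong-≗ {n} (oriented-+ v) ⟩
    ∑[ u < n ] ⟦ adj? v u ⟧
      ≡⟨ sym (degree-∑ v) ⟩
    degree G v ∎
    where
    ends : ∀ x y → oriented x y * ⟦ (v ≟ x) ⊎-dec (v ≟ y) ⟧ ≡
                   ⟦ v ≟ x ⟧ * oriented x y + ⟦ v ≟ y ⟧ * oriented x y
    ends x y = ⟦⟧-*-⟦⊎⟧ (λ ((x<y , _) , v≡x , v≡y) → <⇒≢ x<y (trans (sym v≡x) v≡y))
      (oriented? x y) (v ≟ x) (v ≟ y)

  handshake : ∑[ v < n ] degree G v ≡ size G * 2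
  handshake = begin
    ∑[ v < n ] degree G v                         ≡⟨ sum-cong-≗ {n} (λ v → sym (∑-incident-edges v)) ⟩
    ∑[ v < n ] ∑[ e < size G ] ⟦ incident? v e ⟧  ≡⟨ ∑-comm {n} {size G} _ ⟩
    ∑[ e < size G ] ∑[ v < n ] ⟦ incident? v e ⟧  ≡⟨ sum-cong-≗ {size G} ∑-incident-vertices ⟩
    ∑[ e < size G ] 2                             ≡⟨ ∑-const (size G) 2 ⟩
    size G * 2                                    ∎

-- Degrees in the join and the sum of their cubes.

module _ {n₁ n₂} (G₁ : Graph n₁) (G₂ : Graph n₂) where
  private
    N = n₁ + size G₁
    m₁ = size G₁
  open EdgeSJoin G₁ G₂ using (jAdj?)
  open Subdivision G₁ using (sAdj?; isInserted?; incident?)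

  -- Taking the argument in the disjoint union makes the cubed degree a function of `splitAt N i`,
  -- the form `∑-splitAt` needs.
  joinDegree : Fin N ⊎ Fin n₂ → ℕ
  joinDegree x = ∑[ j < N + n₂ ] ⟦ jAdj? x (splitAt N j) ⟧

  subdivisionDegree : Fin n₁ ⊎ Fin m₁ → ℕ
  subdivisionDegree x = ∑[ j < N ] ⟦ sAdj? x (splitAt n₁ j) ⟧

  subdivisionDegree-original : ∀ v → subdivisionDegree (inj₁ v) ≡ degree G₁ v
  subdivisionDegree-original v = begin
    subdivisionDegree (inj₁ v)
      ≡⟨ ∑-splitAt n₁ (λ y → ⟦ sAdj? (inj₁ v) y ⟧) ⟩
    ∑[ u < n₁ ] 0 + ∑[ e < m₁ ] ⟦ incident? v e ⟧
      ≡⟨ cong₂ _+_ (∑-zero n₁) (∑-incident-edges G₁ v) ⟩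
    degree G₁ v ∎

  subdivisionDegree-inserted : ∀ e → subdivisionDegree (inj₂ e) ≡ 2
  subdivisionDegree-inserted e = begin
    subdivisionDegree (inj₂ e)
      ≡⟨ ∑-splitAt n₁ (λ y → ⟦ sAdj? (inj₂ e) y ⟧) ⟩
    ∑[ v < n₁ ] ⟦ incident? v e ⟧ + ∑[ f < m₁ ] 0
      ≡⟨ cong₂ _+_ (∑-incident-vertices G₁ e) (∑-zero m₁) ⟩
    2 ∎

  -- Adjacency to the vertices of `G₂` does not depend on which one is chosen: the second block is a
  -- constant sum, `n₂` or 0. The first block is `subdivisionDegree` by computation.
  joinDegree-subdivision : ∀ x → joinDegree (inj₁ x) ≡
    subdivisionDegree (splitAt n₁ x) + n₂ * ⟦ isInserted? (splitAt n₁ x) ⟧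
  joinDegree-subdivision x = trans
    (∑-splitAt N (λ y → ⟦ jAdj? (inj₁ x) y ⟧))
    (cong (subdivisionDegree (splitAt n₁ x) +_) (∑-const n₂ _))

  joinDegree-G₂ : ∀ w → joinDegree (inj₂ w) ≡ m₁ + degree G₂ w
  joinDegree-G₂ w = begin
    joinDegree (inj₂ w)
      ≡⟨ ∑-splitAt N (λ y → ⟦ jAdj? (inj₂ w) y ⟧) ⟩
    ∑[ x < N ] ⟦ isInserted? (splitAt n₁ x) ⟧ + ∑[ v < n₂ ] ⟦ Graph.adj? G₂ w v ⟧
      -- Splitting the subdivision vertices once more counts the inserted ones, one for each edge of
      -- `G₁`.
      ≡⟨ cong₂ _+_ (∑-splitAt n₁ (λ x → ⟦ isInserted? x ⟧)) (sym (degree-∑ G₂ w)) ⟩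
    ∑[ v < n₁ ] 0 + ∑[ e < m₁ ] 1 + degree G₂ w
      ≡⟨ cong (_+ degree G₂ w) (cong₂ _+_ (∑-zero n₁) (trans (∑-const m₁ 1) (*-identityʳ m₁))) ⟩
    m₁ + degree G₂ w ∎

  ∑-cube-subdivision : ∑[ x < N ] (joinDegree (inj₁ x) ^ 3) ≡ F-index G₁ + m₁ * (n₂ + 2) ^ 3
  ∑-cube-subdivision = begin
    ∑[ x < N ] (joinDegree (inj₁ x) ^ 3)
      ≡⟨ sum-cong-≗ {N} (λ x → cong (_^ 3) (joinDegree-subdivision x)) ⟩
    ∑[ x < N ] ((subdivisionDegree (splitAt n₁ x) + n₂ * ⟦ isInserted? (splitAt n₁ x) ⟧) ^ 3)
      ≡⟨ ∑-splitAt n₁ (λ x → (subdivisionDegree x + n₂ * ⟦ isInserted? x ⟧) ^ 3) ⟩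
    ∑[ v < n₁ ] ((subdivisionDegree (inj₁ v) + n₂ * 0) ^ 3) +
    ∑[ e < m₁ ] ((subdivisionDegree (inj₂ e) + n₂ * 1) ^ 3)
      ≡⟨ cong₂ _+_ (sum-cong-≗ {n₁} (λ v → cong (_^ 3) (original v)))
                   (trans (sum-cong-≗ {m₁} (λ e → cong (_^ 3) (inserted e))) (∑-const m₁ _)) ⟩
    F-index G₁ + m₁ * (n₂ + 2) ^ 3 ∎
    where
    original : ∀ v → subdivisionDegree (inj₁ v) + n₂ * 0 ≡ degree G₁ v
    original v = trans (cong₂ _+_ (subdivisionDegree-original v) (*-zeroʳ n₂)) (+-identityʳ _)

    inserted : ∀ e → subdivisionDegree (inj₂ e) + n₂ * 1 ≡ n₂ + 2
    inserted e = trans (cong₂ _+_ (subdivisionDegree-inserted e) (*-identityʳ n₂)) (+-comm 2 n₂)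

  ∑-cube-G₂ : ∑[ w < n₂ ] (joinDegree (inj₂ w) ^ 3) ≡
    n₂ * m₁ ^ 3 + 3 * m₁ ^ 2 * (size G₂ * 2) + 3 * m₁ * M₁ G₂ + F-index G₂
  ∑-cube-G₂ = begin
    ∑[ w < n₂ ] (joinDegree (inj₂ w) ^ 3)
      ≡⟨ sum-cong-≗ {n₂} (λ w → cong (_^ 3) (joinDegree-G₂ w)) ⟩
    ∑[ w < n₂ ] ((m₁ + degree G₂ w) ^ 3)
      ≡⟨ ∑-cube-+ m₁ (degree G₂) ⟩
    n₂ * m₁ ^ 3 + 3 * m₁ ^ 2 * ∑[ w < n₂ ] degree G₂ w + 3 * m₁ * M₁ G₂ + F-index G₂
      ≡⟨ cong (λ s → n₂ * m₁ ^ 3 + 3 * m₁ ^ 2 * s + 3 * m₁ * M₁ G₂ + F-index G₂) (handshake G₂) ⟩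
    n₂ * m₁ ^ 3 + 3 * m₁ ^ 2 * (size G₂ * 2) + 3 * m₁ * M₁ G₂ + F-index G₂ ∎

  F-index-∨S : F-index (G₁ ∨S G₂) ≡
    (F-index G₁ + m₁ * (n₂ + 2) ^ 3) +
    (n₂ * m₁ ^ 3 + 3 * m₁ ^ 2 * (size G₂ * 2) + 3 * m₁ * M₁ G₂ + F-index G₂)
  F-index-∨S = begin
    F-index (G₁ ∨S G₂)
      -- The indicator sum for vertex `i` is `joinDegree (splitAt N i)` by computation.
      ≡⟨ sum-cong-≗ {N + n₂} (λ i → cong (_^ 3) (degree-∑ (G₁ ∨S G₂) i)) ⟩
    ∑[ i < N + n₂ ] (joinDegree (splitAt N i) ^ 3)
      ≡⟨ ∑-splitAt N (λ x → joinDegree x ^ 3) ⟩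
    ∑[ x < N ] (joinDegree (inj₁ x) ^ 3) + ∑[ w < n₂ ] (joinDegree (inj₂ w) ^ 3)
      ≡⟨ cong₂ _+_ ∑-cube-subdivision ∑-cube-G₂ ⟩
    _ ∎

theorem2 : ∀ (n₁ n₂ m₁ m₂ : ℕ) (G₁ : Graph n₁) (G₂ : Graph n₂) →
    Connected G₁ → Connected G₂ →
    size G₁ ≡ m₁ → size G₂ ≡ m₂ →
    F-index (G₁ ∨S G₂) ≡
    F-index G₁ + F-index G₂ + 3 * m₁ * M₁ G₂ + 6 * m₁ ^ 2 * m₂
    + m₁ * (n₂ + 2) ^ 3 + n₂ * m₁ ^ 3
theorem2 n₁ n₂ m₁ m₂ G₁ G₂ _ _ refl refl =
  -- Only rearrangement remains; the coefficient 6 is the binomial 3 times the 2 from `handshake`.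
  trans (F-index-∨S G₁ G₂) (lemma (F-index G₁) (F-index G₂) (M₁ G₂) n₂ m₁ m₂)
  where
  lemma : ∀ F₁ F₂ M n₂ m₁ m₂ →
    (F₁ + m₁ * (n₂ + 2) ^ 3) + (n₂ * m₁ ^ 3 + 3 * m₁ ^ 2 * (m₂ * 2) + 3 * m₁ * M + F₂) ≡
    F₁ + F₂ + 3 * m₁ * M + 6 * m₁ ^ 2 * m₂ + m₁ * (n₂ + 2) ^ 3 + n₂ * m₁ ^ 3
  lemma = solve 6 (λ F₁ F₂ M n₂ m₁ m₂ →
    (F₁ :+ m₁ :* (n₂ :+ con 2) :^ 3) :+
      (n₂ :* m₁ :^ 3 :+ con 3 :* m₁ :^ 2 :* (m₂ :* con 2) :+ con 3 :* m₁ :* M :+ F₂) :=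
    F₁ :+ F₂ :+ con 3 :* m₁ :* M :+ con 6 :* m₁ :^ 2 :* m₂ :+ m₁ :* (n₂ :+ con 2) :^ 3 :+ n₂ :* m₁ :^ 3) refl
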